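{- For every $n\geq 3$ and every prime power $q=p^h$, the minimum distance $d(C(PG(n,q))^\perp)$ equals $d(C(PG(2,q))^\perp)$.
   Context: $C(PG(m,q))$ is the $p$-ary code spanned over $\mathbb{F}_p$ by the incidence vectors of the hyperplanes of $PG(m,q)$, with coordinates indexed by points. For $m=2$ the hyperplanes are the lines. $C^\perp$ is the dual code with respect to the standard scalar product over $\mathbb{F}_p$. $d(\cdot)$ denotes minimum distance, i.e. minimum nonzero weight. -}

module Defs where

open import Algebra.Apartness.Structures using (IsHeytingField)
open import Data.Bool.Base using (if_then_else_)
open import Data.Empty using (⊥; ⊥-elim)
open import Data.Fin.Base using (Fin)
import Data.Fin.Properties as Fin
open import Data.List.Base as List using (List; []; _∷_; _++_; length; filter; cartesianProductWith; allFin)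
open import Data.List.Membership.Propositional using (_∈_)
open import Data.List.Membership.Propositional.Properties
  using (∈-map⁺; ∈-map⁻; ∈-allFin; ∈-cartesianProductWith⁺; ∈-++⁺ˡ; ∈-++⁺ʳ)
open import Data.List.Relation.Unary.Any using (here)
import Data.List.Relation.Unary.All as All
import Data.List.Relation.Unary.AllPairs as AllPairs
open import Data.List.Relation.Unary.Unique.Propositional using (Unique)
open import Data.List.Relation.Unary.Unique.Propositional.Properties
  using (map⁺; ++⁺; allFin⁺; cartesianProductWith⁺)
open import Data.Nat.Base using (ℕ; zero; suc; _≤_)
open import Data.Product.Base using (Σ; _×_; _,_; ∃-syntax)
open import Data.Vec.Base as Vec using (Vec; []; _∷_; replicate; zipWith)
import Data.Vec.Properties as Vec
open import Function.Bundles using (_↔_; Inverse)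
open import Function.Properties.Inverse using (↔⇒↣)
open import Level using (0ℓ)
open import Relation.Binary.Definitions using (DecidableEquality)
open import Relation.Binary.PropositionalEquality
  using (_≡_; _≢_; refl; sym; trans; cong; cong₂; subst)
open import Relation.Nullary.Decidable using (Dec; yes; no; ¬?; does; via-injection)
open import Relation.Unary using (Pred)

-- The field with q elements. A Heyting field whose apartness is _≢_ is a
-- (nontrivial) field in the usual sense.
record FiniteField (q : ℕ) : Set₁ where
  infix  8 -_
  infixl 7 _*_
  infixl 6 _+_
  field
    Carrier        : Set
    _+_ _*_        : Carrier → Carrier → Carrier
    -_             : Carrier → Carrier
    0# 1#          : Carrier
    isHeytingField : IsHeytingField _≡_ _≢_ _+_ _*_ -_ 0# 1#
    enumeration    : Carrier ↔ Fin q

  open IsHeytingField isHeytingField public hiding (refl; sym; trans; zero)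

  _≟_ : DecidableEquality Carrier
  _≟_ = via-injection (↔⇒↣ enumeration) Fin._≟_

  elements : List Carrier
  elements = List.map (Inverse.from enumeration) (allFin q)

module ProjectiveSpace {q : ℕ} (F : FiniteField q) where
  open FiniteField F

  0ᵛ : ∀ {k} → Vec Carrier k
  0ᵛ = replicate _ 0#

  infixr 7 _·_
  _·_ : ∀ {k} → Carrier → Vec Carrier k → Vec Carrier k
  a · v = Vec.map (a *_) v

  _∙_ : ∀ {k} → Vec Carrier k → Vec Carrier k → Carrier
  u ∙ v = Vec.foldr′ _+_ 0# (zipWith _*_ u v)

  -- A point of PG(m,q), i.e. a one-dimensional subspace of F^(m+1), is given
  -- by its unique spanning vector whose first nonzero coordinate is 1.
  -- normalise below shows that these vectors represent each such subspace
  -- exactly once.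
  data Point : ℕ → Set where
    1∷_ : ∀ {m} → Vec Carrier m → Point m
    0∷_ : ∀ {m} → Point m → Point (suc m)

  coords : ∀ {m} → Point m → Vec Carrier (suc m)
  coords (1∷ v) = 1# ∷ v
  coords (0∷ P) = 0# ∷ coords P

  vectors : ∀ k → List (Vec Carrier k)
  vectors zero    = [] ∷ []
  vectors (suc k) = cartesianProductWith _∷_ elements (vectors k)

  points : ∀ m → List (Point m)
  points zero    = List.map 1∷_ (vectors zero)
  points (suc m) = List.map 1∷_ (vectors (suc m)) ++ List.map 0∷_ (points m)

  -- A hyperplane is given by a nonzero linear form. Proportional forms give
  -- the same hyperplane, which is harmless since hyperplanes are only used to
  -- generate a span.
  Hyperplane : ℕ → Set
  Hyperplane m = Σ (Vec Carrier (suc m)) (_≢ 0ᵛ)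

  _on_ : ∀ {m} → Point m → Hyperplane m → Set
  P on (a , _) = a ∙ coords P ≡ 0#

  _on?_ : ∀ {m} (P : Point m) (H : Hyperplane m) → Dec (P on H)
  P on? (a , _) = (a ∙ coords P) ≟ 0#

  private
    0≢1 : 0# ≢ 1#
    0≢1 0≡1 = invertible⇒# {0#} {0#} (0# , trans (zeroˡ _) 0≡1 , trans (zeroʳ _) 0≡1) refl

    inverse : ∀ {x} → x ≢ 0# → ∃[ y ] x * y ≡ 1#
    inverse {x} x≢0 with #⇒invertible {x} {0#} x≢0
    ... | y , _ , eq = y , trans (cong (_* y) (sym x-0≡x)) eq
      where
      -0≡0 : - 0# ≡ 0#
      -0≡0 = trans (sym (+-identityˡ (- 0#))) (-‿inverseʳ 0#)
      x-0≡x : x + - 0# ≡ x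
      x-0≡x = trans (cong (x +_) -0≡0) (+-identityʳ x)

    rescale : ∀ {x y} → x * y ≡ 1# → ∀ {k} (v : Vec Carrier k) → v ≡ x · (y · v)
    rescale xy≡1 []      = refl
    rescale {x} {y} xy≡1 (z ∷ v) = cong₂ _∷_
      (trans (sym (*-identityˡ z)) (trans (cong (_* z) (sym xy≡1)) (*-assoc x y z)))
      (rescale xy≡1 v)

    ·-injective : ∀ {x} → x ≢ 0# → ∀ {k} {u v : Vec Carrier k} → x · u ≡ x · v → u ≡ v
    ·-injective x≢0 {u = u} {v} eq with inverse x≢0
    ... | y , xy≡1 = trans (rescale yx≡1 u) (trans (cong (y ·_) eq) (sym (rescale yx≡1 v)))
      where yx≡1 = trans (*-comm y _) xy≡1

    0∷-≢ : ∀ {x} → x ≢ 0# → 0# ≢ x * 1#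
    0∷-≢ x≢0 eq = x≢0 (trans (sym (*-identityʳ _)) (sym eq))

    unique : ∀ {m x y} {P Q : Point m} → x ≢ 0# → y ≢ 0# →
             x · coords P ≡ y · coords Q → P ≡ Q
    unique {x = x} {y} {1∷ u} {1∷ v} x≢0 y≢0 eq = cong 1∷_ (·-injective x≢0
      (trans (Vec.∷-injectiveʳ eq) (cong (_· v) (sym x≡y))))
      where
      x≡y : x ≡ y
      x≡y = trans (sym (*-identityʳ x)) (trans (Vec.∷-injectiveˡ eq) (*-identityʳ y))
    unique {x = x} {y} {1∷ _} {0∷ _} x≢0 y≢0 eq =
      ⊥-elim (0∷-≢ x≢0 (trans (sym (zeroʳ y)) (sym (Vec.∷-injectiveˡ eq))))
    unique {x = x} {y} {0∷ _} {1∷ _} x≢0 y≢0 eq =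
      ⊥-elim (0∷-≢ y≢0 (trans (sym (zeroʳ x)) (Vec.∷-injectiveˡ eq)))
    unique {P = 0∷ _} {0∷ _} x≢0 y≢0 eq =
      cong 0∷_ (unique x≢0 y≢0 (Vec.∷-injectiveʳ eq))

    exists : ∀ {m} (v : Vec Carrier (suc m)) → v ≢ 0ᵛ →
             ∃[ P ] ∃[ x ] x ≢ 0# × v ≡ x · coords {m} P
    exists (x ∷ v) xv≢0 with x ≟ 0#
    ... | no x≢0 with inverse x≢0
    ...   | y , xy≡1 = 1∷ (y · v) , x , x≢0 , cong₂ _∷_ (sym (*-identityʳ x)) (rescale xy≡1 v)
    exists {zero}  (x ∷ []) xv≢0 | yes x≡0 = ⊥-elim (xv≢0 (cong (_∷ []) x≡0))
    exists {suc m} (x ∷ v)  xv≢0 | yes x≡0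
      with exists v (λ v≡0 → xv≢0 (cong₂ _∷_ x≡0 v≡0))
    ... | P , y , y≢0 , eq = 0∷ P , y , y≢0 , cong₂ _∷_ (trans x≡0 (sym (zeroʳ y))) eq

    ∈-elements : ∀ x → x ∈ elements
    ∈-elements x = subst (_∈ elements) (Inverse.strictlyInverseʳ enumeration x)
      (∈-map⁺ (Inverse.from enumeration) (∈-allFin (Inverse.to enumeration x)))

    elements-unique : Unique elements
    elements-unique = map⁺
      (λ {i} {j} eq → trans (sym (Inverse.strictlyInverseˡ enumeration i))
        (trans (cong (Inverse.to enumeration) eq) (Inverse.strictlyInverseˡ enumeration j)))
      (allFin⁺ q)

    ∈-vectors : ∀ {k} (v : Vec Carrier k) → v ∈ vectors k
    ∈-vectors []      = here refl
    ∈-vectors (x ∷ v) = ∈-cartesianProductWith⁺ _∷_ (∈-elements x) (∈-vectors v)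

    vectors-unique : ∀ k → Unique (vectors k)
    vectors-unique zero    = All.[] AllPairs.∷ AllPairs.[]
    vectors-unique (suc k) =
      cartesianProductWith⁺ _∷_ Vec.∷-injective elements-unique (vectors-unique k)

    1∷-injective : ∀ {m} {u v : Vec Carrier m} → 1∷ u ≡ 1∷ v → u ≡ v
    1∷-injective refl = refl

    0∷-injective : ∀ {m} {P Q : Point m} → 0∷ P ≡ 0∷ Q → P ≡ Q
    0∷-injective refl = refl

  coords≢0 : ∀ {m} (P : Point m) → coords P ≢ 0ᵛ
  coords≢0 (1∷ _) eq = 0≢1 (sym (Vec.∷-injectiveˡ eq))
  coords≢0 (0∷ P) eq = coords≢0 P (Vec.∷-injectiveʳ eq)

  normalise : ∀ {m} (v : Vec Carrier (suc m)) → v ≢ 0ᵛ →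
              ∃[ P ] (∃[ x ] x ≢ 0# × v ≡ x · coords {m} P) ×
                     (∀ {Q} → (∃[ y ] y ≢ 0# × v ≡ y · coords Q) → P ≡ Q)
  normalise v v≢0 with exists v v≢0
  ... | P , x , x≢0 , eq = P , (x , x≢0 , eq) ,
    λ (y , y≢0 , eq′) → unique x≢0 y≢0 (trans (sym eq) eq′)

  points-complete : ∀ {m} (P : Point m) → P ∈ points m
  points-complete {zero}  (1∷ v) = ∈-map⁺ 1∷_ (∈-vectors v)
  points-complete {suc m} (1∷ v) = ∈-++⁺ˡ (∈-map⁺ 1∷_ (∈-vectors v))
  points-complete {suc m} (0∷ P) =
    ∈-++⁺ʳ (List.map 1∷_ (vectors (suc m))) (∈-map⁺ 0∷_ (points-complete P))

  points-unique : ∀ m → Unique (points m)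
  points-unique zero    = map⁺ 1∷-injective (vectors-unique zero)
  points-unique (suc m) = ++⁺ (map⁺ 1∷-injective (vectors-unique (suc m)))
    (map⁺ 0∷-injective (points-unique m)) disjoint
    where
    disjoint : ∀ {P} → P ∈ List.map 1∷_ (vectors (suc m)) × P ∈ List.map 0∷_ (points m) → ⊥
    disjoint (P∈ , P∈′) with ∈-map⁻ 1∷_ P∈ | ∈-map⁻ 0∷_ P∈′
    ... | _ , _ , refl | _ , _ , ()

-- Linear codes over K with coordinate positions X, where xs lists every
-- element of X exactly once.
module Codes {p : ℕ} (K : FiniteField p) {X : Set} (xs : List X) where
  open FiniteField K

  Word : Set
  Word = X → Carrier

  Code : Set₁
  Code = Pred Word 0ℓ

  ∑ : {A : Set} → List A → (A → Carrier) → Carrier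
  ∑ as f = List.foldr _+_ 0# (List.map f as)

  ⟨_,_⟩ : Word → Word → Carrier
  ⟨ c , d ⟩ = ∑ xs λ x → c x * d x

  weight : Word → ℕ
  weight c = length (filter (λ x → ¬? (c x ≟ 0#)) xs)

  Span : {I : Set} → (I → Word) → Code
  Span {I} g c = Σ (List (Carrier × I)) λ ts → ∀ x → c x ≡ ∑ ts λ (a , i) → a * g i x

  Dual : Code → Code
  Dual C c = ∀ d → C d → ⟨ c , d ⟩ ≡ 0#

  IsMinimumDistance : Code → ℕ → Set
  IsMinimumDistance C d =
    d ≢ 0 × (∃[ c ] C c × weight c ≡ d) × (∀ c → C c → weight c ≢ 0 → d ≤ weight c)

module HyperplaneCode {p q : ℕ} (K : FiniteField p) (F : FiniteField q) (m : ℕ) where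
  open ProjectiveSpace F
  open Codes K (points m) public
  private
    module K = FiniteField K

  incidenceVector : Hyperplane m → Word
  incidenceVector H P = if does (P on? H) then K.1# else K.0#

  C : Code
  C = Span incidenceVector

  IsMinimumDistanceOfDual : ℕ → Set
  IsMinimumDistanceOfDual = IsMinimumDistance (Dual C)

{-# OPTIONS --safe #-}
-- A K-weighted family of vectors (v j , k j) whose incidence sums vanish on
-- all hyperplanes collapses to a dual word whose weight is at most the number of
-- nonzero k j. Applied to an embedding this moves words of PG(m,q) to
-- PG(m+1,q); applied to the projection from a point R outside the support it
-- moves words back. If P is in the support and some line through P contains no
-- further support point, projecting from another point R of that line leaves
-- the value at P uncancelled, so the image is nonzero. Otherwise every line
-- through P contains a second support point, so the weight is at least the
-- number of points of PG(m,q), which is at least any weight in PG(2,q).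
module Submission where

open import Defs
open import Data.Nat using (ℕ; _≤_; _^_)
open import Data.Nat.Primality using (Prime)
open import Data.Product using (_×_; ∃-syntax)

open import Algebra.Bundles using (CommutativeRing)
import Algebra.Properties.AbelianGroup as AbelianGroupProperties
import Algebra.Properties.CommutativeSemigroup as CommutativeSemigroupProperties
import Algebra.Properties.Monoid.Mult as Mult
import Algebra.Properties.Ring as RingProperties
open import Data.Bool.Base using (if_then_else_)
open import Data.List.Base as List
  using (List; []; _∷_; _++_; length; filter; allFin; cartesianProductWith)
import Data.List.Extrema as Extrema
open import Data.List.Membership.Propositional using (_∈_; lose; find)
open import Data.List.Membership.Propositional.Properties
open import Data.List.Properties
  using (length-map; length-tabulate; length-filter; length-++; length-++-sucʳ; filter-≐)
open import Data.List.Relation.Unary.All as All using (All; []; _∷_)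
open import Data.List.Relation.Unary.All.Properties using (¬All⇒Any¬)
open import Data.List.Relation.Unary.AllPairs using ([]; _∷_)
open import Data.List.Relation.Unary.Any as Any using (Any; here; there)
open import Data.List.Relation.Unary.Unique.Propositional using (Unique)
import Data.List.Relation.Unary.Unique.Propositional.Properties as Unique
open import Data.Nat.Base using (zero; suc; z≤n; s≤s; _≤′_; ≤′-reflexive; ≤′-step)
import Data.Nat.Properties as ℕ
open import Data.Product.Base using (_,_; proj₁; proj₂)
open import Data.Sum.Base using (_⊎_; inj₁; inj₂; [_,_])
open import Data.Sum.Properties using (inj₁-injective; inj₂-injective)
open import Data.Vec.Base as Vec using (Vec; []; _∷_; zipWith)
import Data.Vec.Properties as Vec
open import Function.Base using (_∘_; id)
open import Function.Bundles using (Inverse)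
open import Level using (0ℓ)
open import Relation.Binary.Definitions using (DecidableEquality)
open import Relation.Binary.PropositionalEquality
  using (_≡_; _≢_; refl; sym; trans; cong; cong₂; subst; module ≡-Reasoning)
open import Relation.Nullary
  using (¬_; Dec; yes; no; ¬?; does; contradiction; map′)
open import Relation.Nullary.Decidable using (decidable-stable)
open import Relation.Unary using (Decidable)

-- Counting along an injective relation.

module _ {A B : Set} (R : A → B → Set)
         (R-injective : ∀ {x x′ y} → R x y → R x′ y → x ≡ x′) where

  -- Deleting from `ys` a partner of the first entry leaves partners for all other entries, because
  -- `R-injective` and uniqueness forbid sharing.
  length-≤ : ∀ {xs} ys → Unique xs → (∀ {x} → x ∈ xs → ∃[ y ] y ∈ ys × R x y) →
             length xs ≤ length ys
  length-≤ {[]}     ys []           f = z≤n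
  length-≤ {x ∷ xs} ys (x∉xs ∷ xs!) f with f (here refl)
  ... | y , y∈ys , r with ∈-∃++ y∈ys
  ...   | as , bs , refl =
    subst (suc (length xs) ≤_) (sym (length-++-sucʳ as y bs)) (s≤s (length-≤ (as ++ bs) xs! g))
    where
    g : ∀ {x′} → x′ ∈ xs → ∃[ y′ ] y′ ∈ as ++ bs × R x′ y′
    g x′∈xs with f (there x′∈xs)
    ... | y′ , y′∈ys , r′ with ∈-++⁻ as y′∈ys
    ...   | inj₁ y′∈as         = y′ , ∈-++⁺ˡ y′∈as , r′
    ...   | inj₂ (here refl)   = contradiction (R-injective r r′) (All.lookup x∉xs x′∈xs)
    ...   | inj₂ (there y′∈bs) = y′ , ∈-++⁺ʳ as y′∈bs , r′

-- Arithmetic and enumeration in a finite field.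

module FieldProperties {q} (F : FiniteField q) where
  open FiniteField F

  commutativeRing : CommutativeRing 0ℓ 0ℓ
  commutativeRing = record { isCommutativeRing = isCommutativeRing }

  open CommutativeRing commutativeRing using (ring; +-abelianGroup)
  open CommutativeRing commutativeRing public using (+-monoid)
  open RingProperties ring public using (-‿distribˡ-*; -‿distribʳ-*; -0#≈0#; -‿+-comm)
  open AbelianGroupProperties +-abelianGroup public
    using (xyx⁻¹≈y) renaming (∙-cancelˡ to +-cancelˡ; ∙-cancelʳ to +-cancelʳ; x≈z//y to +⇒-;
              //-rightDividesˡ to -+-cancel)
  open CommutativeSemigroupProperties
    (CommutativeRing.+-commutativeSemigroup commutativeRing) public
    using () renaming (interchange to +-interchange)
  open CommutativeSemigroupProperties
    (CommutativeRing.*-commutativeSemigroup commutativeRing) public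
    using () renaming (x∙yz≈y∙xz to x*yz≡y*xz)

  1≢0 : 1# ≢ 0#
  1≢0 1≡0 = invertible⇒# {0#} {0#}
    (0# , trans (zeroˡ _) (sym 1≡0) , trans (zeroʳ _) (sym 1≡0)) refl

  inverse : ∀ {x} → x ≢ 0# → ∃[ y ] y * x ≡ 1#
  inverse {x} x≢0 with #⇒invertible {x} {0#} x≢0
  ... | y , eq , _ = y , trans (cong (y *_) (sym x-0≡x)) eq
    where
    x-0≡x : x + - 0# ≡ x
    x-0≡x = trans (cong (x +_) -0#≈0#) (+-identityʳ x)

  inverse≢0 : ∀ {x y} → y * x ≡ 1# → y ≢ 0#
  inverse≢0 yx≡1 refl = 1≢0 (trans (sym yx≡1) (zeroˡ _))

  ∈-elements : ∀ x → x ∈ elements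
  ∈-elements x = subst (_∈ elements) (Inverse.strictlyInverseʳ enumeration x)
    (∈-map⁺ (Inverse.from enumeration) (∈-allFin (Inverse.to enumeration x)))

  elements-unique : Unique elements
  elements-unique = Unique.map⁺
    (λ {i} {j} eq → trans (sym (Inverse.strictlyInverseˡ enumeration i))
      (trans (cong (Inverse.to enumeration) eq) (Inverse.strictlyInverseˡ enumeration j)))
    (Unique.allFin⁺ q)

  length-elements : length elements ≡ q
  length-elements = trans (length-map _ (allFin q)) (length-tabulate id)

-- Finite sums, indicators and the characteristic.

module Summation {p} (K : FiniteField p) where
  open FiniteField K
  open FieldProperties K
  open ≡-Reasoning
  open Mult +-monoid using () renaming (_×_ to infixr 7 _⊗_; ×-assocˡ to ⊗-assocˡ)

  ∑ : {A : Set} → List A → (A → Carrier) → Carrier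
  ∑ as f = List.foldr _+_ 0# (List.map f as)

  module _ {A : Set} where

    ∑-cong : ∀ as {f g : A → Carrier} → (∀ {a} → a ∈ as → f a ≡ g a) → ∑ as f ≡ ∑ as g
    ∑-cong []       f≡g = refl
    ∑-cong (a ∷ as) f≡g = cong₂ _+_ (f≡g (here refl)) (∑-cong as (f≡g ∘ there))

    ∑-zero : ∀ as {f : A → Carrier} → (∀ {a} → a ∈ as → f a ≡ 0#) → ∑ as f ≡ 0#
    ∑-zero []       f≡0 = refl
    ∑-zero (a ∷ as) f≡0 =
      trans (cong₂ _+_ (f≡0 (here refl)) (∑-zero as (f≡0 ∘ there))) (+-identityˡ 0#)

    ∑-+ : ∀ as (f g : A → Carrier) → ∑ as (λ a → f a + g a) ≡ ∑ as f + ∑ as g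
    ∑-+ []       f g = sym (+-identityˡ 0#)
    ∑-+ (a ∷ as) f g =
      trans (cong (f a + g a +_) (∑-+ as f g)) (+-interchange (f a) (g a) (∑ as f) (∑ as g))

    ∑-*ˡ : ∀ as x (f : A → Carrier) → ∑ as (λ a → x * f a) ≡ x * ∑ as f
    ∑-*ˡ []       x f = sym (zeroʳ x)
    ∑-*ˡ (a ∷ as) x f = trans (cong (x * f a +_) (∑-*ˡ as x f)) (sym (distribˡ x (f a) (∑ as f)))

    ∑-*ʳ : ∀ as x (f : A → Carrier) → ∑ as (λ a → f a * x) ≡ ∑ as f * x
    ∑-*ʳ []       x f = sym (zeroˡ x)
    ∑-*ʳ (a ∷ as) x f = trans (cong (f a * x +_) (∑-*ʳ as x f)) (sym (distribʳ x (f a) (∑ as f)))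

    ∑-++ : ∀ as bs (f : A → Carrier) → ∑ (as ++ bs) f ≡ ∑ as f + ∑ bs f
    ∑-++ []       bs f = sym (+-identityˡ _)
    ∑-++ (a ∷ as) bs f = trans (cong (f a +_) (∑-++ as bs f)) (sym (+-assoc (f a) (∑ as f) (∑ bs f)))

    ∑-map : {B : Set} (h : B → A) → ∀ bs (f : A → Carrier) → ∑ (List.map h bs) f ≡ ∑ bs (f ∘ h)
    ∑-map h []       f = refl
    ∑-map h (b ∷ bs) f = cong (f (h b) +_) (∑-map h bs f)

    ∑-const : ∀ (as : List A) x → ∑ as (λ _ → x) ≡ length as ⊗ x
    ∑-const []       x = refl
    ∑-const (a ∷ as) x = cong (x +_) (∑-const as x)

    ∑-single : ∀ {as a} (f : A → Carrier) → Unique as → a ∈ as →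
               (∀ {b} → b ≢ a → f b ≡ 0#) → ∑ as f ≡ f a
    ∑-single {a ∷ as} f (a∉as ∷ as!) (here refl) f≡0 =
      trans (cong (f a +_) (∑-zero as λ b∈as → f≡0 (All.lookup a∉as b∈as ∘ sym))) (+-identityʳ (f a))
    ∑-single {b ∷ as} f (b∉as ∷ as!) (there a∈as) f≡0 =
      trans (cong₂ _+_ (f≡0 (All.lookup b∉as a∈as)) (∑-single f as! a∈as f≡0)) (+-identityˡ _)

    ∑-nonzero : ∀ as (f : A → Carrier) → ∑ as f ≢ 0# → ∃[ a ] a ∈ as × f a ≢ 0#
    ∑-nonzero []       f s≢0 = contradiction refl s≢0
    ∑-nonzero (a ∷ as) f s≢0 with f a ≟ 0#
    ... | no fa≢0 = a , here refl , fa≢0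
    ... | yes fa≡0 with ∑-nonzero as f (λ s≡0 → s≢0 (trans (cong₂ _+_ fa≡0 s≡0) (+-identityˡ 0#)))
    ...   | b , b∈as , fb≢0 = b , there b∈as , fb≢0

  ∑-swap : ∀ {A B : Set} as bs (f : A → B → Carrier) →
           ∑ as (λ a → ∑ bs (f a)) ≡ ∑ bs (λ b → ∑ as (λ a → f a b))
  ∑-swap []       bs f = sym (∑-zero bs λ _ → refl)
  ∑-swap (a ∷ as) bs f = trans (cong (∑ bs (f a) +_) (∑-swap as bs f))
    (sym (∑-+ bs (f a) (λ b → ∑ as (λ a → f a b))))

  -- The same `if` as in `incidenceVector`, so that indicators of incidence are entries of incidence
  -- vectors by definition.
  χ : ∀ {A : Set} → Dec A → Carrier
  χ d = if does d then 1# else 0#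

  χ-yes : ∀ {A : Set} (d : Dec A) → A → χ d ≡ 1#
  χ-yes (yes _) a = refl
  χ-yes (no ¬a) a = contradiction a ¬a

  χ-no : ∀ {A : Set} (d : Dec A) → ¬ A → χ d ≡ 0#
  χ-no (yes a) ¬a = contradiction a ¬a
  χ-no (no _)  ¬a = refl

  χ-cong : ∀ {A B : Set} (d : Dec A) (e : Dec B) → (A → B) → (B → A) → χ d ≡ χ e
  χ-cong (yes a) e A→B B→A = sym (χ-yes e (A→B a))
  χ-cong (no ¬a) e A→B B→A = sym (χ-no e (¬a ∘ B→A))

  -- Each term is expanded as a sum over its possible values `z`. After exchanging the sums, exactly
  -- one `x`, namely `z + - y`, contributes to a given `z`.
  ∑-translate : ∀ y → ∑ elements (λ x → x + y) ≡ ∑ elements id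
  ∑-translate y = begin
    ∑ elements (λ x → x + y)
      ≡⟨ ∑-cong elements (λ {x} _ → sym (trans
           (∑-single (λ z → χ (z ≟ (x + y)) * z) elements-unique (∈-elements (x + y))
             λ {z} z≢ → trans (cong (_* z) (χ-no (z ≟ (x + y)) z≢)) (zeroˡ z))
           (trans (cong (_* (x + y)) (χ-yes ((x + y) ≟ (x + y)) refl)) (*-identityˡ _)))) ⟩
    ∑ elements (λ x → ∑ elements (λ z → χ (z ≟ (x + y)) * z))
      ≡⟨ ∑-swap elements elements (λ x z → χ (z ≟ (x + y)) * z) ⟩
    ∑ elements (λ z → ∑ elements (λ x → χ (z ≟ (x + y)) * z))
      ≡⟨ ∑-cong elements (λ {z} _ → trans
           (∑-single (λ x → χ (z ≟ (x + y)) * z) elements-unique (∈-elements (z + - y))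
             λ {x} x≢ → trans (cong (_* z) (χ-no (z ≟ (x + y))
               (λ z≡x+y → x≢ (+⇒- x y z (sym z≡x+y))))) (zeroˡ z))
           (trans (cong (_* z) (χ-yes (z ≟ (z + - y + y)) (sym (-+-cancel y z)))) (*-identityˡ z))) ⟩
    ∑ elements id ∎

  -- Adding `x` to every element permutes the field, so the sum of all elements grows by `p ⊗ x` and
  -- yet stays the same.
  order⊗≡0 : ∀ x → p ⊗ x ≡ 0#
  order⊗≡0 x = +-cancelˡ (∑ elements id) _ _ (begin
    ∑ elements id + p ⊗ x                   ≡⟨ cong (λ n → ∑ elements id + n ⊗ x) length-elements ⟨
    ∑ elements id + length elements ⊗ x     ≡⟨ cong (∑ elements id +_) (∑-const elements x) ⟨
    ∑ elements id + ∑ elements (λ _ → x)    ≡⟨ ∑-+ elements id (λ _ → x) ⟨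
    ∑ elements (λ y → y + x)                ≡⟨ ∑-translate x ⟩
    ∑ elements id                           ≡⟨ +-identityʳ _ ⟨
    ∑ elements id + 0#                      ∎)

  -- As `h` is positive, one factor `p` splits off from the power.
  power⊗≡0 : ∀ {h} → 1 ≤ h → ∀ x → (p ^ h) ⊗ x ≡ 0#
  power⊗≡0 {suc h} _ x = trans (sym (⊗-assocˡ x p (p ^ h))) (order⊗≡0 _)

-- Vectors, points and projection from a point.

module Projection {q} (F : FiniteField q) where
  open FiniteField F
  open FieldProperties F
  open ProjectiveSpace F
  open ≡-Reasoning

  infixl 6 _⊕_
  _⊕_ : ∀ {k} → Vec Carrier k → Vec Carrier k → Vec Carrier k
  _⊕_ = zipWith _+_

  infix 4 _~_ _~?_
  _~_ : ∀ {m} → Vec Carrier (suc m) → Point m → Set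
  v ~ P = ∃[ x ] x ≢ 0# × v ≡ x · coords P

  _≟ᵛ_ : ∀ {k} → DecidableEquality (Vec Carrier k)
  _≟ᵛ_ = Vec.≡-dec _≟_

  _≟ᴾ_ : ∀ {m} → DecidableEquality (Point m)
  (1∷ u) ≟ᴾ (1∷ v) = map′ (cong 1∷_) (λ { refl → refl }) (u ≟ᵛ v)
  (1∷ _) ≟ᴾ (0∷ _) = no λ ()
  (0∷ _) ≟ᴾ (1∷ _) = no λ ()
  (0∷ P) ≟ᴾ (0∷ Q) = map′ (cong 0∷_) (λ { refl → refl }) (P ≟ᴾ Q)

  ·-zeroˡ : ∀ {k} (v : Vec Carrier k) → 0# · v ≡ 0ᵛ
  ·-zeroˡ []      = refl
  ·-zeroˡ (x ∷ v) = cong₂ _∷_ (zeroˡ x) (·-zeroˡ v)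

  ·-zeroʳ : ∀ k x → x · 0ᵛ {k} ≡ 0ᵛ
  ·-zeroʳ zero    x = refl
  ·-zeroʳ (suc k) x = cong₂ _∷_ (zeroʳ x) (·-zeroʳ k x)

  ·-identity : ∀ {k} (v : Vec Carrier k) → 1# · v ≡ v
  ·-identity []      = refl
  ·-identity (x ∷ v) = cong₂ _∷_ (*-identityˡ x) (·-identity v)

  ·-assoc : ∀ {k} x y (v : Vec Carrier k) → (x * y) · v ≡ x · y · v
  ·-assoc x y []      = refl
  ·-assoc x y (z ∷ v) = cong₂ _∷_ (*-assoc x y z) (·-assoc x y v)

  ⊕-identityˡ : ∀ {k} (v : Vec Carrier k) → 0ᵛ ⊕ v ≡ v
  ⊕-identityˡ []      = refl
  ⊕-identityˡ (x ∷ v) = cong₂ _∷_ (+-identityˡ x) (⊕-identityˡ v)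

  ·-cancel : ∀ {k x y} {u v : Vec Carrier k} → y * x ≡ 1# → u ≡ x · v → v ≡ y · u
  ·-cancel {x = x} {y} {v = v} yx≡1 refl =
    trans (sym (·-identity v)) (trans (cong (_· v) (sym yx≡1)) (·-assoc y x v))

  ∙-zeroˡ : ∀ {k} (v : Vec Carrier k) → 0ᵛ ∙ v ≡ 0#
  ∙-zeroˡ []      = refl
  ∙-zeroˡ (x ∷ v) = trans (cong₂ _+_ (zeroˡ x) (∙-zeroˡ v)) (+-identityˡ 0#)

  ∙-· : ∀ {k} (a : Vec Carrier k) x v → a ∙ (x · v) ≡ x * (a ∙ v)
  ∙-· []      x []      = sym (zeroʳ x)
  ∙-· (b ∷ a) x (y ∷ v) = begin
    b * (x * y) + a ∙ (x · v)    ≡⟨ cong₂ _+_ (x*yz≡y*xz b x y) (∙-· a x v) ⟩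
    x * (b * y) + x * (a ∙ v)    ≡⟨ distribˡ x (b * y) (a ∙ v) ⟨
    x * (b * y + a ∙ v)          ∎

  ∙-⊕ : ∀ {k} (a u v : Vec Carrier k) → a ∙ (u ⊕ v) ≡ a ∙ u + a ∙ v
  ∙-⊕ []      []      []      = sym (+-identityˡ 0#)
  ∙-⊕ (b ∷ a) (x ∷ u) (y ∷ v) = trans (cong₂ _+_ (distribˡ b x y) (∙-⊕ a u v))
    (+-interchange (b * x) (b * y) (a ∙ u) (a ∙ v))

  ~-refl : ∀ {m} (P : Point m) → coords P ~ P
  ~-refl P = 1# , 1≢0 , sym (·-identity (coords P))

  ~-sym : ∀ {m} {v : Vec Carrier (suc m)} {P : Point m} →
          v ~ P → ∃[ x ] x ≢ 0# × coords P ≡ x · v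
  ~-sym (x , x≢0 , eq) with inverse x≢0
  ... | y , yx≡1 = y , inverse≢0 yx≡1 , ·-cancel yx≡1 eq

  ~-nonzero : ∀ {m} {v : Vec Carrier (suc m)} {P : Point m} → v ~ P → v ≢ 0ᵛ
  ~-nonzero {m} {P = P} v~P v≡0 with ~-sym v~P
  ... | y , _ , eq = coords≢0 P (trans eq (trans (cong (y ·_) v≡0) (·-zeroʳ (suc m) y)))

  ~-unique : ∀ {m} {v : Vec Carrier (suc m)} {P Q : Point m} → v ~ P → v ~ Q → P ≡ Q
  ~-unique v~P v~Q with normalise _ (~-nonzero v~P)
  ... | _ , _ , R≡ = trans (sym (R≡ v~P)) (R≡ v~Q)

  -- Only the decided proposition matters later, so the normalisation behind it stays opaque.
  abstract
    _~?_ : ∀ {m} (v : Vec Carrier (suc m)) (P : Point m) → Dec (v ~ P)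
    v ~? P with v ≟ᵛ 0ᵛ
    ... | yes v≡0 = no λ v~P → ~-nonzero v~P v≡0
    ... | no  v≢0 with normalise v v≢0
    ...   | Q , v~Q , Q≡ = map′ (λ Q≡P → subst (v ~_) Q≡P v~Q) Q≡ (Q ≟ᴾ P)

  -- The scalar cannot vanish, since `coords P` is nonzero, and a point is determined by any vector
  -- that spans it.
  coords-~ : ∀ {m} {P Q : Point m} {x} → coords P ≡ x · coords Q → P ≡ Q
  coords-~ {P = P} {Q} {x} eq = ~-unique (~-refl P) (x , x≢0 , eq)
    where
    x≢0 : x ≢ 0#
    x≢0 refl = coords≢0 P (trans eq (·-zeroˡ (coords Q)))

  proportional : ∀ {m} {u v : Vec Carrier (suc m)} {P : Point m} →
                 u ~ P → v ~ P → ∃[ x ] u ≡ x · v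
  proportional {v = v} (x , _ , refl) v~P with ~-sym v~P
  ... | y , _ , eq = x * y , trans (cong (x ·_) eq) (sym (·-assoc x y v))

  -- The linear map with kernel spanned by R that drops the pivot coordinate of R.
  proj : ∀ {m} → Point m → Vec Carrier (suc m) → Vec Carrier m
  proj (1∷ r) (x ∷ v) = v ⊕ (- x) · r
  proj (0∷ R) (x ∷ v) = x ∷ proj R v

  -- Linear forms pull back along linear maps, which turns hyperplane sums of a projected word into
  -- hyperplane sums of the original one. The coefficient `- (a ∙ r)` makes the new form vanish on
  -- `R`.
  proj-adjoint : ∀ {m} (R : Point m) a → ∃[ b ] ∀ v → a ∙ proj R v ≡ b ∙ v
  proj-adjoint (1∷ r) a = - (a ∙ r) ∷ a , λ { (x ∷ v) → begin
    a ∙ (v ⊕ (- x) · r)         ≡⟨ ∙-⊕ a v ((- x) · r) ⟩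
    a ∙ v + a ∙ ((- x) · r)     ≡⟨ cong (a ∙ v +_) (∙-· a (- x) r) ⟩
    a ∙ v + - x * (a ∙ r)       ≡⟨ +-comm _ _ ⟩
    - x * (a ∙ r) + a ∙ v       ≡⟨ cong (_+ a ∙ v) (-‿distribˡ-* x (a ∙ r)) ⟨
    - (x * (a ∙ r)) + a ∙ v     ≡⟨ cong (λ y → - y + a ∙ v) (*-comm x (a ∙ r)) ⟩
    - ((a ∙ r) * x) + a ∙ v     ≡⟨ cong (_+ a ∙ v) (-‿distribˡ-* (a ∙ r) x) ⟩
    - (a ∙ r) * x + a ∙ v       ∎ }
  proj-adjoint (0∷ R) (c ∷ a) with proj-adjoint R a
  ... | b , eq = c ∷ b , λ { (x ∷ v) → cong (c * x +_) (eq v) }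

  -- Combines linearity of `proj P` with the fact that `P` lies in its kernel, in the single form in
  -- which later arguments use both.
  proj-combination : ∀ {m} (P : Point m) z y v →
                     proj P (z · coords P ⊕ y · v) ≡ y · proj P v
  proj-combination (1∷ r) z y (w ∷ v) = go r v
    where
    entry : ∀ r v → (z * r + y * v) + - (z * 1# + y * w) * r ≡ y * (v + - w * r)
    entry r v = begin
      (z * r + y * v) + - (z * 1# + y * w) * r
        ≡⟨ cong (λ t → (z * r + y * v) + - (t + y * w) * r) (*-identityʳ z) ⟩
      (z * r + y * v) + - (z + y * w) * r
        ≡⟨ cong ((z * r + y * v) +_) (-‿distribˡ-* (z + y * w) r) ⟨
      (z * r + y * v) + - ((z + y * w) * r)
        ≡⟨ cong (λ t → (z * r + y * v) + - t) (distribʳ r z (y * w)) ⟩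
      (z * r + y * v) + - (z * r + y * w * r)
        ≡⟨ cong ((z * r + y * v) +_) (-‿+-comm (z * r) (y * w * r)) ⟨
      (z * r + y * v) + (- (z * r) + - (y * w * r))
        ≡⟨ +-assoc (z * r + y * v) _ _ ⟨
      (z * r + y * v) + - (z * r) + - (y * w * r)
        ≡⟨ cong₂ _+_ (xyx⁻¹≈y (z * r) (y * v)) (cong -_ (*-assoc y w r)) ⟩
      y * v + - (y * (w * r))
        ≡⟨ cong (y * v +_) (-‿distribʳ-* y (w * r)) ⟩
      y * v + y * - (w * r)
        ≡⟨ distribˡ y v (- (w * r)) ⟨
      y * (v + - (w * r))
        ≡⟨ cong (λ t → y * (v + t)) (-‿distribˡ-* w r) ⟩
      y * (v + - w * r) ∎
    go : ∀ {k} (r v : Vec Carrier k) →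
         z · r ⊕ y · v ⊕ (- (z * 1# + y * w)) · r ≡ y · (v ⊕ (- w) · r)
    go []      []      = refl
    go (s ∷ r) (t ∷ v) = cong₂ _∷_ (entry s t) (go r v)
  proj-combination (0∷ P) z y (w ∷ v) = cong₂ _∷_
    (trans (cong (_+ y * w) (zeroʳ z)) (+-identityˡ (y * w))) (proj-combination P z y v)

  proj-scale : ∀ {m} (P : Point m) y v → proj P (y · v) ≡ y · proj P v
  proj-scale P y v = trans
    (cong (proj P) (sym (trans (cong (_⊕ y · v) (·-zeroˡ (coords P))) (⊕-identityˡ (y · v)))))
    (proj-combination P 0# y v)

  -- The kernel of `proj R` is spanned by `R`, so vectors with equal images differ by a multiple of
  -- `R`. The multiple is read off at the pivot, where `R` has the entry 1.
  proj-fibre : ∀ {m} (R : Point m) {z u v} → proj R u ≡ z · proj R v →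
               ∃[ y ] u ≡ z · v ⊕ y · coords R
  proj-fibre (1∷ r) {z} {x ∷ u} {w ∷ v} eq = x + - (z * w) ,
    cong₂ _∷_ head (go r u v eq)
    where
    head : x ≡ z * w + (x + - (z * w)) * 1#
    head = sym (trans (cong (z * w +_) (*-identityʳ _))
      (trans (+-comm (z * w) _) (-+-cancel (z * w) x)))
    entry : ∀ r u v → u + - x * r ≡ z * (v + - w * r) → u ≡ z * v + (x + - (z * w)) * r
    entry r u v eq = sym (begin
      z * v + (x + - (z * w)) * r           ≡⟨ cong (z * v +_) (distribʳ r x (- (z * w))) ⟩
      z * v + (x * r + - (z * w) * r)       ≡⟨ cong (z * v +_) (+-comm (x * r) _) ⟩
      z * v + (- (z * w) * r + x * r)       ≡⟨ +-assoc (z * v) _ _ ⟨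
      z * v + - (z * w) * r + x * r         ≡⟨ cong (λ t → z * v + t * r + x * r) (-‿distribʳ-* z w) ⟩
      z * v + z * - w * r + x * r           ≡⟨ cong (λ t → z * v + t + x * r) (*-assoc z (- w) r) ⟩
      z * v + z * (- w * r) + x * r         ≡⟨ cong (_+ x * r) (distribˡ z v (- w * r)) ⟨
      z * (v + - w * r) + x * r             ≡⟨ cong (_+ x * r) eq ⟨
      u + - x * r + x * r                   ≡⟨ cong (λ t → u + t + x * r) (-‿distribˡ-* x r) ⟨
      u + - (x * r) + x * r                 ≡⟨ -+-cancel (x * r) u ⟩
      u                                     ∎)
    go : ∀ {k} (r u v : Vec Carrier k) → u ⊕ (- x) · r ≡ z · (v ⊕ (- w) · r) →
         u ≡ z · v ⊕ (x + - (z * w)) · r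
    go []      []      []      _  = refl
    go (s ∷ r) (t ∷ u) (t′ ∷ v) eq = cong₂ _∷_
      (entry s t t′ (Vec.∷-injectiveˡ eq)) (go r u v (Vec.∷-injectiveʳ eq))
  proj-fibre (0∷ R) {z} {x ∷ u} {w ∷ v} eq with proj-fibre R (Vec.∷-injectiveʳ eq)
  ... | y , eq′ = y , cong₂ _∷_
    (trans (Vec.∷-injectiveˡ eq) (sym (trans (cong (z * w +_) (zeroʳ y)) (+-identityʳ (z * w))))) eq′

  proj-kernel : ∀ {m} {R Q : Point m} → proj R (coords Q) ≡ 0ᵛ → Q ≡ R
  proj-kernel {R = R} {Q} eq
    -- With `z` zero the fibre statement describes the kernel: `coords Q` is a multiple of
    -- `coords R`.
    with proj-fibre R {z = 0#} {v = coords Q} (trans eq (sym (·-zeroˡ (proj R (coords Q)))))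
  ... | y , eq′ = coords-~ (trans eq′
    (trans (cong (_⊕ y · coords R) (·-zeroˡ (coords Q))) (⊕-identityˡ (y · coords R))))

  proj-self : ∀ {m} (P : Point m) → proj P (coords P) ≡ 0ᵛ
  proj-self P = begin
    proj P (coords P)                          ≡⟨ cong (proj P) (·-identity (coords P)) ⟨
    proj P (1# · coords P)                     ≡⟨ cong (proj P) (⊕-identityˡ′ (1# · coords P)) ⟨
    proj P (1# · coords P ⊕ 0# · coords P)     ≡⟨ proj-combination P 1# 0# (coords P) ⟩
    0# · proj P (coords P)                     ≡⟨ ·-zeroˡ _ ⟩
    0ᵛ                                         ∎
    where
    ⊕-identityˡ′ : ∀ v → v ⊕ 0# · coords P ≡ v
    ⊕-identityˡ′ v = trans (cong (v ⊕_) (·-zeroˡ (coords P)))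
      (Vec.zipWith-identityʳ +-identityʳ v)

  -- A linear right inverse of `proj R`, inserting 0 at the pivot.
  lift : ∀ {m} → Point m → Vec Carrier m → Vec Carrier (suc m)
  lift (1∷ r) v       = 0# ∷ v
  lift (0∷ R) (x ∷ v) = x ∷ lift R v

  proj-lift : ∀ {m} (R : Point m) v → proj R (lift R v) ≡ v
  proj-lift (1∷ r) v       = trans (cong (v ⊕_) (trans (cong (_· r) -0#≈0#) (·-zeroˡ r)))
    (Vec.zipWith-identityʳ +-identityʳ v)
  proj-lift (0∷ R) (x ∷ v) = cong (x ∷_) (proj-lift R v)

  -- A point `D` of the quotient at `P` is a line through `P`; lifting `D` and normalising picks a
  -- point of that line other than `P`.
  point-in-direction : ∀ {m} (P : Point (suc m)) (D : Point m) → ∃[ R ] proj P (coords R) ~ D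
  point-in-direction {m} P D with normalise (lift P (coords D)) lift≢0
    where
    lift≢0 : lift P (coords D) ≢ 0ᵛ
    lift≢0 eq = coords≢0 D (begin
      coords D                          ≡⟨ proj-lift P (coords D) ⟨
      proj P (lift P (coords D))        ≡⟨ cong (proj P) eq ⟩
      proj P 0ᵛ                         ≡⟨ cong (proj P) (·-zeroˡ 0ᵛ) ⟨
      proj P (0# · 0ᵛ)                  ≡⟨ proj-scale P 0# 0ᵛ ⟩
      0# · proj P 0ᵛ                    ≡⟨ ·-zeroˡ _ ⟩
      0ᵛ                                ∎)
  ... | R , (x , x≢0 , eq) , _ with inverse x≢0
  ...   | y , yx≡1 = R , y , inverse≢0 yx≡1 , ·-cancel yx≡1 (begin
    coords D                          ≡⟨ proj-lift P (coords D) ⟨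
    proj P (lift P (coords D))        ≡⟨ cong (proj P) eq ⟩
    proj P (x · coords R)             ≡⟨ proj-scale P x (coords R) ⟩
    x · proj P (coords R)             ∎)

  -- Q lies on the line PR, whose direction at P is D.
  proj-collinear : ∀ {m} {P Q R : Point (suc m)} {D E : Point m} → proj P (coords R) ~ D →
                   proj R (coords Q) ~ E → proj R (coords P) ~ E → Q ≢ P → proj P (coords Q) ~ D
  proj-collinear {P = P} {Q} {R} {D} (x , x≢0 , R~D) Q~E P~E Q≢P with proportional Q~E P~E
  -- Proportional images from `R` write `coords Q` as `z · coords P ⊕ y · coords R`, and `proj P`
  -- kills the first summand.
  ... | z , eq with proj-fibre R eq
  ...   | y , eq′ = y * x , yx≢0 , Q≡
    where
    Q≡ : proj P (coords Q) ≡ (y * x) · coords D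
    Q≡ = begin
      proj P (coords Q)                       ≡⟨ cong (proj P) eq′ ⟩
      proj P (z · coords P ⊕ y · coords R)    ≡⟨ proj-combination P z y (coords R) ⟩
      y · proj P (coords R)                   ≡⟨ cong (y ·_) R~D ⟩
      y · x · coords D                        ≡⟨ ·-assoc y x (coords D) ⟨
      (y * x) · coords D                      ∎
    yx≢0 : y * x ≢ 0#
    yx≢0 yx≡0 = Q≢P (proj-kernel (trans Q≡ (trans (cong (_· coords D) yx≡0) (·-zeroˡ (coords D)))))

-- Supports, weights and attained minima.

module Weight {p} (K : FiniteField p) {X : Set} {xs : List X} (x∈xs : ∀ x → x ∈ xs) where
  open FiniteField K
  open FieldProperties K
  open Summation K
  open Codes K xs using (Word; Code; weight; IsMinimumDistance)

  support : Word → List X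
  support c = filter (λ x → ¬? (c x ≟ 0#)) xs

  ∈-support : ∀ {c x} → c x ≢ 0# → x ∈ support c
  ∈-support {c} = ∈-filter⁺ (λ x → ¬? (c x ≟ 0#)) (x∈xs _)

  support-nonzero : ∀ {c x} → x ∈ support c → c x ≢ 0#
  support-nonzero {c} = proj₂ ∘ ∈-filter⁻ (λ x → ¬? (c x ≟ 0#)) {xs = xs}

  weight≢0⇒ : ∀ c → weight c ≢ 0 → ∃[ x ] c x ≢ 0#
  weight≢0⇒ c w≢0 with support c in eq
  ... | []    = contradiction refl w≢0
  ... | x ∷ _ = x , support-nonzero {c} (subst (x ∈_) (sym eq) (here refl))

  weight≢0 : ∀ c {x} → c x ≢ 0# → weight c ≢ 0
  weight≢0 c cx≢0 = ℕ.n>0⇒n≢0 (∈-length (∈-support {c} cx≢0))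

  weight-cong : ∀ {c c′} → (∀ x → c x ≡ c′ x) → weight c ≡ weight c′
  weight-cong {c} {c′} c≗c′ = cong length
    (filter-≐ (λ x → ¬? (c x ≟ 0#)) (λ x → ¬? (c′ x ≟ 0#))
      ((λ {x} → subst (_≢ 0#) (c≗c′ x)) , (λ {x} → subst (_≢ 0#) (sym (c≗c′ x)))) xs)

  module _ (_≟ˣ_ : DecidableEquality X) where

    update : X → Carrier → Word → Word
    update x k c y = if does (y ≟ˣ x) then k else c y

    -- Words are functions, so they are listed only up to pointwise agreement on the given
    -- positions; elsewhere the value is 0.
    wordsOn : List X → List Word
    wordsOn []       = (λ _ → 0#) ∷ []
    wordsOn (y ∷ ys) = cartesianProductWith (update y) elements (wordsOn ys)

    wordsOn-complete : ∀ c ys → ∃[ c′ ] c′ ∈ wordsOn ys × (∀ {y} → y ∈ ys → c y ≡ c′ y)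
    wordsOn-complete c []       = (λ _ → 0#) , here refl , λ ()
    wordsOn-complete c (y ∷ ys) with wordsOn-complete c ys
    ... | c′ , c′∈ , c≗c′ =
      update y (c y) c′ , ∈-cartesianProductWith⁺ (update y) (∈-elements (c y)) c′∈ , agree
      where
      agree : ∀ {z} → z ∈ y ∷ ys → c z ≡ update y (c y) c′ z
      agree {z} z∈ with z ≟ˣ y | z∈
      ... | yes z≡y | _          = cong c z≡y
      ... | no  z≢y | here z≡y   = contradiction z≡y z≢y
      ... | no  _   | there z∈ys = c≗c′ z∈ys

    -- Up to pointwise equality there are finitely many words, and pointwise equal words agree in
    -- weight and in membership in `C`. Hence a search through a list finds a nonzero word of least
    -- weight.
    minimum-distance-exists :
      (C : Code) → Decidable C → (∀ {c c′} → (∀ x → c x ≡ c′ x) → C c → C c′) →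
      (∃[ c ] C c × weight c ≢ 0) → ∃[ d ] IsMinimumDistance C d
    minimum-distance-exists C C? C-resp (c₀ , Cc₀ , c₀≢0) =
      weight c , proj₂ c-nonzero , (c , proj₁ c-nonzero , refl) , minimal
      where
      open Extrema ℕ.≤-totalOrder
      P : Word → Set
      P c = C c × weight c ≢ 0
      P? : Decidable P
      P? c with C? c | weight c ℕ.≟ 0
      ... | yes Cc | no  c≢0 = yes (Cc , c≢0)
      ... | no ¬Cc | _       = no (¬Cc ∘ proj₁)
      ... | yes _  | yes c≡0 = no λ (_ , c≢0) → c≢0 c≡0
      candidates : List Word
      candidates = filter P? (wordsOn xs)
      c : Word
      -- The default `c₀` satisfies `P` itself, so the result does as well, even if `candidates` is
      -- empty.
      c = argmin weight c₀ candidates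
      c-nonzero : P c
      c-nonzero = argmin-all weight (Cc₀ , c₀≢0)
        (All.tabulate (proj₂ ∘ ∈-filter⁻ P? {xs = wordsOn xs}))
      minimal : ∀ c′ → C c′ → weight c′ ≢ 0 → weight c ≤ weight c′
      minimal c′ Cc′ c′≢0 with wordsOn-complete c′ xs
      ... | c″ , c″∈ , c′≗c″ = subst (weight c ≤_) (sym w≡)
        (All.lookup (f[argmin]≤f[xs] c₀ candidates)
          (∈-filter⁺ P? c″∈ (C-resp eq Cc′ , λ w≡0 → c′≢0 (trans w≡ w≡0))))
        where
        eq : ∀ x → c′ x ≡ c″ x
        eq x = c′≗c″ (x∈xs x)
        w≡ : weight c′ ≡ weight c″
        w≡ = weight-cong eq

-- Dual words and push-forward of weighted vectors.

module DualWords {p q} (K : FiniteField p) (F : FiniteField q) where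
  open FiniteField K
  open FieldProperties K
  open Summation K
  open ProjectiveSpace F
  open Projection F
  open Codes K using (Dual; weight)
  open ≡-Reasoning
  private
    module F where
      open FiniteField F public
      open FieldProperties F public
    module HC = HyperplaneCode K F
    module W {m} = Weight K (points-complete {m})

  Word : ℕ → Set
  Word = HC.Word

  DualWord : ∀ {m} → Word m → Set
  DualWord {m} = Dual (points m) (HC.C m)

  incidence : ∀ {m} (a : Vec F.Carrier (suc m)) (v : Vec F.Carrier (suc m)) → Carrier
  incidence a v = χ ((a ∙ v) F.≟ F.0#)

  -- The scalar product of `c` with a hyperplane, extended to the zero form, where it is the sum of
  -- all values of `c`.
  pairing : ∀ {m} → Word m → Vec F.Carrier (suc m) → Carrier
  pairing {m} c a = ∑ (points m) λ P → c P * incidence a (coords P)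

  pairing-cong : ∀ {m} {c c′ : Word m} → (∀ P → c P ≡ c′ P) → ∀ a → pairing c a ≡ pairing c′ a
  pairing-cong c≗c′ a = ∑-cong (points _) λ {P} _ → cong (_* _) (c≗c′ P)

  -- Orthogonality to the generators extends to their span by exchanging the two sums.
  dual-intro : ∀ {m} {c : Word m} → (∀ a → a ≢ 0ᵛ → pairing c a ≡ 0#) → DualWord c
  dual-intro {m} {c} orth d (ts , d≡) = begin
    ∑ (points m) (λ P → c P * d P)
      ≡⟨ ∑-cong (points m) (λ {P} _ → trans (cong (c P *_) (d≡ P)) (sym (∑-*ˡ ts (c P) _))) ⟩
    ∑ (points m) (λ P → ∑ ts λ (x , H) → c P * (x * HC.incidenceVector m H P))
      ≡⟨ ∑-swap (points m) ts _ ⟩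
    ∑ ts (λ (x , H) → ∑ (points m) λ P → c P * (x * HC.incidenceVector m H P))
      ≡⟨ ∑-zero ts (λ {(x , a , a≢0)} _ → begin
           ∑ (points m) (λ P → c P * (x * incidence a (coords P)))
             ≡⟨ ∑-cong (points m) (λ {P} _ → x*yz≡y*xz (c P) x _) ⟩
           ∑ (points m) (λ P → x * (c P * incidence a (coords P)))
             ≡⟨ ∑-*ˡ (points m) x (λ P → c P * incidence a (coords P)) ⟩
           x * pairing c a
             ≡⟨ cong (x *_) (orth a a≢0) ⟩
           x * 0#
             ≡⟨ zeroʳ x ⟩
           0# ∎) ⟩
    0# ∎

  dual-elim : ∀ {m} {c : Word m} → DualWord c → ∀ a → a ≢ 0ᵛ → pairing c a ≡ 0#
  dual-elim {m} {c} dual a a≢0 = dual (λ P → incidence a (coords P))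
    ((1# , a , a≢0) ∷ [] , λ P → sym (trans (+-identityʳ _) (*-identityˡ _)))

  module Collapse {J : Set} (js : List J) {m} (v : J → Vec F.Carrier (suc m)) (k : J → Carrier) where

    -- The push-forward of the weights `k` along `v`: weights of vectors that span the same point
    -- are added.
    collapse : Word m
    collapse P = ∑ js λ j → χ (v j ~? P) * k j

    private
      summand-≁ : ∀ {j P} → ¬ v j ~ P → χ (v j ~? P) * k j ≡ 0#
      summand-≁ {j} {P} v≁P = trans (cong (_* k j) (χ-no (v j ~? P) v≁P)) (zeroˡ (k j))

      summand-~ : ∀ {j P} → v j ~ P → χ (v j ~? P) * k j ≡ k j
      summand-~ {j} {P} v~P = trans (cong (_* k j) (χ-yes (v j ~? P) v~P)) (*-identityˡ (k j))

    -- After exchanging the sums, each `j` counts only at the one point that `v j` spans, and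
    -- incidence is unchanged by scaling. A zero vector spans no point although every form vanishes
    -- on it, so its weight has to be 0.
    collapse-dual : (∀ a → a ≢ 0ᵛ → ∑ js (λ j → k j * incidence a (v j)) ≡ 0#) →
                    (∀ j → v j ≡ 0ᵛ → k j ≡ 0#) → DualWord collapse
    collapse-dual orth v≡0⇒k≡0 = dual-intro {c = collapse} λ a a≢0 → begin
      ∑ (points m) (λ P → collapse P * incidence a (coords P))
        ≡⟨ ∑-cong (points m) (λ {P} _ → sym (∑-*ʳ js (incidence a (coords P)) _)) ⟩
      ∑ (points m) (λ P → ∑ js λ j → χ (v j ~? P) * k j * incidence a (coords P))
        ≡⟨ ∑-swap (points m) js _ ⟩
      ∑ js (λ j → ∑ (points m) λ P → χ (v j ~? P) * k j * incidence a (coords P))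
        ≡⟨ ∑-cong js (λ {j} _ → at a j) ⟩
      ∑ js (λ j → k j * incidence a (v j))
        ≡⟨ orth a a≢0 ⟩
      0# ∎
      where
      at : ∀ a j → ∑ (points m) (λ P → χ (v j ~? P) * k j * incidence a (coords P)) ≡
                   k j * incidence a (v j)
      at a j with v j ≟ᵛ 0ᵛ
      ... | yes v≡0 = trans
        (∑-zero (points m) λ {P} _ → trans
          (cong (_* incidence a (coords P)) (trans (cong (χ (v j ~? P) *_) k≡0) (zeroʳ _))) (zeroˡ _))
        (sym (trans (cong (_* incidence a (v j)) k≡0) (zeroˡ _)))
        where
        k≡0 : k j ≡ 0#
        k≡0 = v≡0⇒k≡0 j v≡0
      ... | no v≢0 with normalise (v j) v≢0
      ...   | P , v~P@(x , x≢0 , v≡xP) , _ = trans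
        (∑-single (λ Q → χ (v j ~? Q) * k j * incidence a (coords Q)) (points-unique m) (points-complete P)
          λ {Q} Q≢P → trans
            (cong (_* incidence a (coords Q)) (summand-≁ λ v~Q → Q≢P (~-unique v~Q v~P))) (zeroˡ _))
        (cong₂ _*_ (summand-~ v~P)
          (χ-cong ((a ∙ coords P) F.≟ F.0#) ((a ∙ v j) F.≟ F.0#)
            (λ aP≡0 → trans (cong (a ∙_) v≡xP)
              (trans (∙-· a x (coords P)) (trans (cong (x F.*_) aP≡0) (F.zeroʳ x))))
            (λ av≡0 → let y , _ , P≡yv = ~-sym v~P in trans (cong (a ∙_) P≡yv)
              (trans (∙-· a y (v j)) (trans (cong (y F.*_) av≡0) (F.zeroʳ y))))))

    -- A nonzero value at `P` needs some `j` of nonzero weight over `P`, and no `j` lies over two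
    -- points.
    weight-collapse : weight (points m) collapse ≤ length (filter (λ j → ¬? (k j ≟ 0#)) js)
    weight-collapse = length-≤ (λ P j → v j ~ P) ~-unique _
      (Unique.filter⁺ (λ P → ¬? (collapse P ≟ 0#)) (points-unique m))
      λ {P} P∈ → preimage (W.support-nonzero {c = collapse} P∈)
      where
      preimage : ∀ {P} → collapse P ≢ 0# →
                 ∃[ j ] j ∈ filter (λ j → ¬? (k j ≟ 0#)) js × v j ~ P
      preimage {P} cP≢0 with ∑-nonzero js _ cP≢0
      ... | j , j∈js , χk≢0 = j , ∈-filter⁺ (λ j → ¬? (k j ≟ 0#)) j∈js k≢0 , v~P
        where
        k≢0 : k j ≢ 0#
        k≢0 k≡0 = χk≢0 (trans (cong (χ (v j ~? P) *_) k≡0) (zeroʳ _))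
        v~P : v j ~ P
        v~P = decidable-stable (v j ~? P) (χk≢0 ∘ summand-≁)

    -- Nothing can cancel at a point over which only one index has nonzero weight. This is how
    -- images are shown to be nonzero.
    collapse-single : Unique js → ∀ {j P} → j ∈ js → v j ~ P →
                      (∀ i → k i ≢ 0# → v i ~ P → i ≡ j) → collapse P ≡ k j
    collapse-single js! {j} {P} j∈js vj~P only-j = trans
      (∑-single (λ i → χ (v i ~? P) * k i) js! j∈js zero-elsewhere) (summand-~ vj~P)
      where
      zero-elsewhere : ∀ {i} → i ≢ j → χ (v i ~? P) * k i ≡ 0#
      zero-elsewhere {i} i≢j with k i ≟ 0#
      ... | yes k≡0 = trans (cong (χ (v i ~? P) *_) k≡0) (zeroʳ _)
      ... | no  k≢0 = summand-≁ λ vi~P → i≢j (only-j i k≢0 vi~P)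

  -- Hyperplane sums in equal characteristic.

  -- The remaining facts need q = 0 in K, i.e. that K and F have the same characteristic.
  module _ (q⊗≡0 : ∀ x → Mult._×_ +-monoid q x ≡ 0#) where

    -- Either `a` is zero and the sum consists of q copies of one value, which vanish in `K`, or
    -- exactly one `t` is a root and the last term is 0.
    ∑-pencil : ∀ a b → ∑ F.elements (λ t → χ (((t F.* a) F.+ b) F.≟ F.0#)) + χ (a F.≟ F.0#) ≡ 1#
    ∑-pencil a b with a F.≟ F.0#
    ... | yes a≡0 = trans (cong₂ _+_ (begin
      ∑ F.elements (λ t → χ (((t F.* a) F.+ b) F.≟ F.0#))
        ≡⟨ ∑-cong F.elements (λ {t} _ → cong (λ x → χ (x F.≟ F.0#))
             (trans (cong (F._+ b) (trans (cong (t F.*_) a≡0) (F.zeroʳ t))) (F.+-identityˡ b))) ⟩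
      ∑ F.elements (λ _ → χ (b F.≟ F.0#))
        ≡⟨ ∑-const F.elements _ ⟩
      Mult._×_ +-monoid (length F.elements) (χ (b F.≟ F.0#))
        ≡⟨ cong (λ n → Mult._×_ +-monoid n (χ (b F.≟ F.0#))) F.length-elements ⟩
      Mult._×_ +-monoid q (χ (b F.≟ F.0#))
        ≡⟨ q⊗≡0 _ ⟩
      0# ∎) (χ-yes (a F.≟ F.0#) a≡0)) (+-identityˡ 1#)
    ... | no a≢0 with F.inverse a≢0
    ...   | a⁻¹ , a⁻¹a≡1 = trans (cong₂ _+_ (trans
      (∑-single (λ t → χ (((t F.* a) F.+ b) F.≟ F.0#)) F.elements-unique (F.∈-elements root)
        λ {t} t≢ → χ-no (((t F.* a) F.+ b) F.≟ F.0#) λ ta+b≡0 → t≢ (begin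
          t                        ≡⟨ F.*-identityʳ t ⟨
          t F.* F.1#               ≡⟨ cong (t F.*_) (trans (F.*-comm a a⁻¹) a⁻¹a≡1) ⟨
          t F.* (a F.* a⁻¹)        ≡⟨ F.*-assoc t a a⁻¹ ⟨
          t F.* a F.* a⁻¹          ≡⟨ cong (F._* a⁻¹) (F.+⇒- (t F.* a) b F.0# ta+b≡0) ⟩
          (F.0# F.+ F.- b) F.* a⁻¹ ≡⟨ cong (F._* a⁻¹) (F.+-identityˡ (F.- b)) ⟩
          root                     ∎))
      (χ-yes (((root F.* a) F.+ b) F.≟ F.0#) (begin
        (F.- b) F.* a⁻¹ F.* a F.+ b     ≡⟨ cong (F._+ b) (F.*-assoc (F.- b) a⁻¹ a) ⟩
        (F.- b) F.* (a⁻¹ F.* a) F.+ b   ≡⟨ cong (λ x → (F.- b) F.* x F.+ b) a⁻¹a≡1 ⟩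
        (F.- b) F.* F.1# F.+ b          ≡⟨ cong (F._+ b) (F.*-identityʳ (F.- b)) ⟩
        (F.- b) F.+ b                   ≡⟨ F.-‿inverseˡ b ⟩
        F.0#                            ∎))) (χ-no (a F.≟ F.0#) a≢0)) (+-identityʳ 1#)
      where
      root : F.Carrier
      root = (F.- b) F.* a⁻¹

    -- The hyperplanes with forms (t , 1 , 0 , …) and (1 , 0 , …) form a pencil
    -- covering each point once modulo p.
    ∑-dual : ∀ {m} {c : Word (suc m)} → DualWord c → ∑ (points (suc m)) c ≡ 0#
    ∑-dual {m} {c} dual = begin
      ∑ (points (suc m)) c
        ≡⟨ ∑-cong (points (suc m)) (λ {P} _ → sym (trans (cong (c P *_) (cover P)) (*-identityʳ (c P)))) ⟩
      ∑ (points (suc m)) (λ P → c P * (∑ F.elements (λ t → incidence (form t) (coords P)) +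
                                       incidence form∞ (coords P)))
        ≡⟨ ∑-cong (points (suc m)) (λ {P} _ → trans (distribˡ (c P) _ _)
             (cong (_+ c P * incidence form∞ (coords P)) (sym (∑-*ˡ F.elements (c P) _)))) ⟩
      ∑ (points (suc m)) (λ P → ∑ F.elements (λ t → c P * incidence (form t) (coords P)) +
                                c P * incidence form∞ (coords P))
        ≡⟨ ∑-+ (points (suc m)) _ _ ⟩
      ∑ (points (suc m)) (λ P → ∑ F.elements (λ t → c P * incidence (form t) (coords P))) +
        pairing c form∞
        ≡⟨ cong₂ _+_ (∑-swap (points (suc m)) F.elements _) (dual-elim {c = c} dual form∞ form∞≢0) ⟩
      ∑ F.elements (λ t → pairing c (form t)) + 0#
        ≡⟨ +-identityʳ _ ⟩
      ∑ F.elements (λ t → pairing c (form t))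
        ≡⟨ ∑-zero F.elements (λ {t} _ → dual-elim {c = c} dual (form t) (form≢0 t)) ⟩
      0# ∎
      where
      form : F.Carrier → Vec F.Carrier (suc (suc m))
      form t = t ∷ F.1# ∷ 0ᵛ
      form∞ : Vec F.Carrier (suc (suc m))
      form∞ = F.1# ∷ 0ᵛ
      form≢0 : ∀ t → form t ≢ 0ᵛ
      form≢0 t eq = F.1≢0 (Vec.∷-injectiveˡ (Vec.∷-injectiveʳ eq))
      form∞≢0 : form∞ ≢ 0ᵛ
      form∞≢0 eq = F.1≢0 (Vec.∷-injectiveˡ eq)
      cover : ∀ P → ∑ F.elements (λ t → incidence (form t) (coords P)) +
                    incidence form∞ (coords P) ≡ 1#
      cover P with coords P
      ... | a ∷ v = trans (cong (∑ F.elements (λ t → incidence (form t) (a ∷ v)) +_)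
        (cong (λ x → χ (x F.≟ F.0#))
          (trans (cong₂ F._+_ (F.*-identityˡ a) (∙-zeroˡ v)) (F.+-identityʳ a))))
        (∑-pencil a ((F.1# ∷ 0ᵛ) ∙ v))

    -- The zero form pairs to the sum of all values, which is 0 by `∑-dual`. It has to be covered
    -- because a nonzero form can restrict to zero on a subspace.
    pairing≡0 : ∀ {m} {c : Word (suc m)} → DualWord c → ∀ a → pairing c a ≡ 0#
    pairing≡0 {m} {c} dual a with a ≟ᵛ 0ᵛ
    ... | no  a≢0 = dual-elim {c = c} dual a a≢0
    ... | yes a≡0 = trans (∑-cong (points (suc m)) λ {P} _ → trans
      (cong (c P *_) (χ-yes ((a ∙ coords P) F.≟ F.0#) (trans (cong (_∙ coords P) a≡0) (∙-zeroˡ (coords P)))))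
      (*-identityʳ (c P))) (∑-dual {c = c} dual)

    -- Embedding and projecting dual words.

    embed : ∀ m (c : Word (suc m)) → DualWord c → weight (points (suc m)) c ≢ 0 →
            ∃[ c′ ] DualWord c′ × weight (points (suc (suc m))) c′ ≢ 0 ×
                    weight (points (suc (suc m))) c′ ≤ weight (points (suc m)) c
    embed m c dual c≢0 with W.weight≢0⇒ c c≢0
    ... | P , cP≢0 = collapse , collapse-dual orth (λ Q eq → contradiction (Vec.∷-injectiveʳ eq) (coords≢0 Q)) ,
          W.weight≢0 collapse (subst (_≢ 0#) (sym value) cP≢0) , weight-collapse
      where
      -- The space is placed as the hyperplane of vectors with first coordinate 0.
      v : Point (suc m) → Vec F.Carrier (suc (suc (suc m)))
      v Q = F.0# ∷ coords Q
      open Collapse (points (suc m)) v c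
      orth : ∀ a → a ≢ 0ᵛ → ∑ (points (suc m)) (λ Q → c Q * incidence a (v Q)) ≡ 0#
      -- The restricted form `a` may be zero, hence `pairing≡0` rather than `dual-elim`.
      orth (b ∷ a) _ = trans
        (∑-cong (points (suc m)) λ {Q} _ → cong (λ x → c Q * χ (x F.≟ F.0#))
          (trans (cong (F._+ (a ∙ coords Q)) (F.zeroʳ b)) (F.+-identityˡ (a ∙ coords Q))))
        (pairing≡0 {c = c} dual a)
      value : collapse (0∷ P) ≡ c P
      value = collapse-single (points-unique (suc m)) (points-complete P) (~-refl (0∷ P))
        λ _ _ (x , _ , eq) → coords-~ (Vec.∷-injectiveʳ eq)

    -- `D` is a line through `P` without further support points, and `R` is another point of it.
    -- Hence `c` vanishes at `R`, whose image is lost, and the value at `P` reaches `E` uncancelled.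
    project-from : ∀ {m} (c : Word (suc m)) → DualWord c → ∀ {P R D E} →
                   c P ≢ 0# → (∀ {Q} → c Q ≢ 0# → ¬ proj P (coords Q) ~ D) →
                   proj P (coords R) ~ D → proj R (coords P) ~ E →
                   ∃[ c′ ] DualWord c′ × weight (points m) c′ ≢ 0 ×
                           weight (points m) c′ ≤ weight (points (suc m)) c
    project-from {m} c dual {P} {R} {D} {E} cP≢0 unmet R~D P~E =
      collapse , collapse-dual orth kernel ,
      W.weight≢0 collapse (subst (_≢ 0#) (sym value) cP≢0) , weight-collapse
      where
      v : Point (suc m) → Vec F.Carrier (suc m)
      v Q = proj R (coords Q)
      open Collapse (points (suc m)) v c
      orth : ∀ a → a ≢ 0ᵛ → ∑ (points (suc m)) (λ Q → c Q * incidence a (v Q)) ≡ 0#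
      orth a _ = let b , adj = proj-adjoint R a in trans
        (∑-cong (points (suc m)) λ {Q} _ → cong (λ x → c Q * χ (x F.≟ F.0#)) (adj (coords Q)))
        (pairing≡0 {c = c} dual b)
      kernel : ∀ Q → v Q ≡ 0ᵛ → c Q ≡ 0#
      kernel Q eq = trans (cong c (proj-kernel {R = R} eq))
        (decidable-stable (c R ≟ 0#) λ cR≢0 → unmet cR≢0 R~D)
      value : collapse E ≡ c P
      value = collapse-single (points-unique (suc m)) (points-complete P) P~E
        -- A second support point over `E` would lie on the line `PR`, against `unmet`.
        λ Q cQ≢0 Q~E → decidable-stable (Q ≟ᴾ P)
          λ Q≢P → unmet cQ≢0 (proj-collinear R~D Q~E P~E Q≢P)

    project : ∀ m (c : Word (suc m)) → DualWord c → weight (points (suc m)) c ≢ 0 →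
              length (points m) ≤ weight (points (suc m)) c ⊎
              (∃[ c′ ] DualWord c′ × weight (points m) c′ ≢ 0 ×
                       weight (points m) c′ ≤ weight (points (suc m)) c)
    project m c dual c≢0 = [ inj₁ ∘ large , inj₂ ∘ tangent ∘ find ] (all-or-any met? (points m))
      where
      P : Point (suc m)
      P = proj₁ (W.weight≢0⇒ c c≢0)
      -- The line `D` through `P` carries a support point other than `P`; `P` itself projects to the
      -- zero vector, which spans no point.
      Met : Point m → Set
      Met D = Any (λ Q → proj P (coords Q) ~ D) (W.support c)
      met? : Decidable Met
      met? D = Any.any? (λ Q → proj P (coords Q) ~? D) (W.support c)
      all-or-any : ∀ {A : Set} {T : A → Set} → Decidable T → ∀ xs → All T xs ⊎ Any (¬_ ∘ T) xs
      all-or-any T? xs with All.all? T? xs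
      ... | yes all = inj₁ all
      ... | no ¬all = inj₂ (¬All⇒Any¬ T? xs ¬all)
      large : All Met (points m) → length (points m) ≤ weight (points (suc m)) c
      -- Distinct lines through `P` meet only in `P`, so they need distinct support points.
      large met = length-≤ (λ D Q → proj P (coords Q) ~ D) ~-unique (W.support c) (points-unique m)
        λ D∈ → find (All.lookup met D∈)
      tangent : (∃[ D ] D ∈ points m × ¬ Met D) →
                ∃[ c′ ] DualWord c′ × weight (points m) c′ ≢ 0 ×
                        weight (points m) c′ ≤ weight (points (suc m)) c
      tangent (D , _ , ¬met) =
        let R , R~D         = point-in-direction P D
            -- If `P` projected to zero from `R`, then `P` would be `R`; but seen from `P`, the
            -- point `R` has the direction `D`.
            projP≢0 eq      = ~-nonzero R~D (trans
              (cong (proj P ∘ coords) (sym (proj-kernel {R = R} {Q = P} eq))) (proj-self P))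
            E , P~E , _     = normalise (proj R (coords P)) projP≢0
        in project-from c dual (proj₂ (W.weight≢0⇒ c c≢0))
             (λ cQ≢0 Q~D → ¬met (lose (W.∈-support {c = c} cQ≢0) Q~D)) R~D P~E

    -- Comparison across dimensions.

    embed* : ∀ {m n} → m ≤′ n → (c : Word (suc m)) → DualWord c → weight (points (suc m)) c ≢ 0 →
             ∃[ c′ ] DualWord c′ × weight (points (suc n)) c′ ≢ 0 ×
                     weight (points (suc n)) c′ ≤ weight (points (suc m)) c
    embed* (≤′-reflexive refl) c dual c≢0 = c , dual , c≢0 , ℕ.≤-refl
    embed* (≤′-step m≤n)       c dual c≢0 =
      let c′ , dual′ , c′≢0 , c′≤c  = embed* m≤n c dual c≢0
          c″ , dual″ , c″≢0 , c″≤c′ = embed _ c′ dual′ c′≢0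
      in c″ , dual″ , c″≢0 , ℕ.≤-trans c″≤c′ c′≤c

    length-points-mono : ∀ {m n} → m ≤′ n → length (points m) ≤ length (points n)
    length-points-mono (≤′-reflexive refl)    = ℕ.≤-refl
    length-points-mono {n = suc n} (≤′-step m≤n) = ℕ.≤-trans (length-points-mono m≤n)
      (subst (_≤ length (points (suc n))) (length-map 0∷_ (points n))
        (ℕ.≤-trans (ℕ.m≤n+m _ (length affine)) (ℕ.≤-reflexive (sym (length-++ affine)))))
      where
      affine : List (Point (suc n))
      affine = List.map 1∷_ (vectors (suc n))

    -- Descends one dimension at a time. Either projection gives a nonzero word of no larger weight
    -- one dimension lower, or the weight is at least a number of points that bounds `d`, since `d`
    -- is itself the weight of a word.
    lower-bound : ∀ {m n d} → m ≤′ n → HC.IsMinimumDistanceOfDual (suc m) d →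
                  ∀ (c : Word (suc n)) → DualWord c → weight (points (suc n)) c ≢ 0 →
                  d ≤ weight (points (suc n)) c
    lower-bound (≤′-reflexive refl) (_ , _ , minimal) = minimal
    lower-bound {m} {suc n} {d} (≤′-step m≤n) min@(_ , (c₀ , _ , c₀≡d) , _) c dual c≢0 =
      [ (λ large → ℕ.≤-trans d≤length (ℕ.≤-trans (length-points-mono (ℕ.s≤′s m≤n)) large))
      , (λ (c′ , dual′ , c′≢0 , c′≤c) → ℕ.≤-trans (lower-bound m≤n min c′ dual′ c′≢0) c′≤c)
      ] (project (suc n) c dual c≢0)
      where
      d≤length : d ≤ length (points (suc m))
      d≤length = subst (_≤ length (points (suc m))) c₀≡d
        (length-filter (λ P → ¬? (c₀ P ≟ 0#)) (points (suc m)))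

    -- The plane: a nonzero dual word and an attained minimum.

    -- The difference of the lines through (1 , 0 , 0) and (0 , 1 , 0), resp.
    -- (0 , 0 , 1), given by its values at the points other than (1 , 0 , 0).
    line-difference : ∃[ c ] DualWord c × weight (points 2) c ≢ 0
    line-difference = collapse , collapse-dual (λ a _ → orth a) v≡0⇒ ,
      W.weight≢0 collapse (subst (_≢ 0#) (sym value) 1≢0)
      where
      J : Set
      J = F.Carrier ⊎ F.Carrier
      js : List J
      js = List.map inj₁ F.elements ++ List.map inj₂ F.elements
      v : J → Vec F.Carrier 3
      v (inj₁ t) = t ∷ F.1# ∷ F.0# ∷ []
      v (inj₂ t) = t ∷ F.0# ∷ F.1# ∷ []
      k : J → Carrier
      k (inj₁ _) = 1#
      k (inj₂ _) = - 1#
      open Collapse js v k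
      v≡0⇒ : ∀ j → v j ≡ 0ᵛ → k j ≡ 0#
      v≡0⇒ (inj₁ t) eq = contradiction (Vec.∷-injectiveˡ (Vec.∷-injectiveʳ eq)) F.1≢0
      v≡0⇒ (inj₂ t) eq =
        contradiction (Vec.∷-injectiveˡ (Vec.∷-injectiveʳ (Vec.∷-injectiveʳ eq))) F.1≢0
      js-unique : Unique js
      js-unique = Unique.++⁺ (Unique.map⁺ inj₁-injective F.elements-unique)
        (Unique.map⁺ inj₂-injective F.elements-unique) disjoint
        where
        disjoint : ∀ {j} → ¬ (j ∈ List.map inj₁ F.elements × j ∈ List.map inj₂ F.elements)
        disjoint (j∈₁ , j∈₂) with ∈-map⁻ inj₁ j∈₁ | ∈-map⁻ inj₂ j∈₂
        ... | _ , _ , refl | _ , _ , ()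
      P : Point 2
      P = 0∷ (1∷ (F.0# ∷ []))
      value : collapse P ≡ 1#
      -- The index `inj₁ F.0#` gives (0 , 1 , 0), the coordinates of `P`, and no other index spans
      -- `P`.
      value = collapse-single js-unique {inj₁ F.0#} (∈-++⁺ˡ (∈-map⁺ inj₁ (F.∈-elements F.0#)))
        (~-refl P) only
        where
        only : ∀ j → k j ≢ 0# → v j ~ P → j ≡ inj₁ F.0#
        only (inj₁ t) _ (x , _ , eq) = cong inj₁ (trans (Vec.∷-injectiveˡ eq) (F.zeroʳ x))
        only (inj₂ t) _ (x , _ , eq) = contradiction
          (trans (Vec.∷-injectiveˡ (Vec.∷-injectiveʳ (Vec.∷-injectiveʳ eq))) (F.zeroʳ x)) F.1≢0
      -- The added term is the incidence with (1 , 0 , 0). For nonzero `w` this completes the sum to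
      -- a full line, which meets any line in 1 or in all q + 1 points, so in 1 modulo p.
      ∑-line : ∀ (a : Vec F.Carrier 3) w →
               ∑ F.elements (λ t → incidence a (t ∷ w)) + χ (Vec.head a F.≟ F.0#) ≡ 1#
      ∑-line (a₀ ∷ a) w = trans
        (cong (_+ χ (a₀ F.≟ F.0#)) (∑-cong F.elements λ {t} _ →
          cong (λ x → χ ((x F.+ (a ∙ w)) F.≟ F.0#)) (F.*-comm a₀ t)))
        (∑-pencil a₀ (a ∙ w))
      orth : ∀ a → ∑ js (λ j → k j * incidence a (v j)) ≡ 0#
      orth a = begin
        ∑ js (λ j → k j * incidence a (v j))
          ≡⟨ ∑-++ (List.map inj₁ F.elements) (List.map inj₂ F.elements) _ ⟩
        ∑ (List.map inj₁ F.elements) (λ j → k j * incidence a (v j)) +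
        ∑ (List.map inj₂ F.elements) (λ j → k j * incidence a (v j))
          ≡⟨ cong₂ _+_ (∑-map inj₁ F.elements _) (∑-map inj₂ F.elements _) ⟩
        ∑ F.elements (λ t → 1# * incidence a (v (inj₁ t))) +
        ∑ F.elements (λ t → - 1# * incidence a (v (inj₂ t)))
          ≡⟨ cong₂ _+_ (∑-*ˡ F.elements 1# _) (∑-*ˡ F.elements (- 1#) _) ⟩
        1# * ∑₁ + - 1# * ∑₂
          ≡⟨ cong (λ x → 1# * x + - 1# * ∑₂) ∑₁≡∑₂ ⟩
        1# * ∑₂ + - 1# * ∑₂
          ≡⟨ distribʳ ∑₂ 1# (- 1#) ⟨
        (1# + - 1#) * ∑₂
          ≡⟨ cong (_* ∑₂) (-‿inverseʳ 1#) ⟩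
        0# * ∑₂
          ≡⟨ zeroˡ ∑₂ ⟩
        0# ∎
        where
        ∑₁ ∑₂ : Carrier
        ∑₁ = ∑ F.elements (λ t → incidence a (v (inj₁ t)))
        ∑₂ = ∑ F.elements (λ t → incidence a (v (inj₂ t)))
        ∑₁≡∑₂ : ∑₁ ≡ ∑₂
        -- Both lines sum to 1 and share the point (1 , 0 , 0), whose term cancels.
        ∑₁≡∑₂ = +-cancelʳ (χ (Vec.head a F.≟ F.0#)) ∑₁ ∑₂
          (trans (∑-line a (F.1# ∷ F.0# ∷ [])) (sym (∑-line a (F.0# ∷ F.1# ∷ []))))

    ∈-vectors : ∀ {k} (a : Vec F.Carrier k) → a ∈ vectors k
    ∈-vectors []      = here refl
    ∈-vectors (x ∷ a) = ∈-cartesianProductWith⁺ _∷_ (F.∈-elements x) (∈-vectors a)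

    -- Duality quantifies over all words of the span, but finitely many forms decide it; a dual word
    -- also passes the test at the zero form, by `pairing≡0`.
    dual? : ∀ {m} → Decidable (DualWord {suc m})
    dual? {m} c = map′
      (λ all → dual-intro {c = c} λ a _ → All.lookup all (∈-vectors a))
      (λ dual → All.tabulate λ {a} _ → pairing≡0 {c = c} dual a)
      (All.all? (λ a → pairing c a ≟ 0#) (vectors (suc (suc m))))

    plane-minimum-distance : ∃[ d ] HC.IsMinimumDistanceOfDual 2 d
    plane-minimum-distance = W.minimum-distance-exists _≟ᴾ_ DualWord dual?
      (λ {c} {c′} c≗c′ dual → dual-intro {c = c′} λ a _ →
        trans (sym (pairing-cong c≗c′ a)) (pairing≡0 {c = c} dual a))
      line-difference

    -- Embedding a minimum word yields weight at most `d`, and `lower-bound` keeps every nonzero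
    -- weight from falling below `d`.
    minimum-distance-transfer : ∀ {m n d} → m ≤′ n → HC.IsMinimumDistanceOfDual (suc m) d →
                                HC.IsMinimumDistanceOfDual (suc n) d
    minimum-distance-transfer {n = n} {d} m≤n min@(d≢0 , (c , dual , c≡d) , _) =
      let c′ , dual′ , c′≢0 , c′≤c = embed* m≤n c dual (d≢0 ∘ trans (sym c≡d))
      in d≢0 , (c′ , dual′ , ℕ.≤-antisym (subst (weight (points (suc n)) c′ ≤_) c≡d c′≤c)
                                (lower-bound m≤n min c′ dual′ c′≢0)) , lower-bound m≤n min

mainTheorem14 : (n p h : ℕ) → 3 ≤ n → Prime p → 1 ≤ h →
    (K : FiniteField p) (F : FiniteField (p ^ h)) →
    ∃[ d ] HyperplaneCode.IsMinimumDistanceOfDual K F n d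
    × HyperplaneCode.IsMinimumDistanceOfDual K F 2 d
mainTheorem14 (suc n) p h (s≤s 2≤n) _ 1≤h K F =
  let open DualWords K F
      q⊗≡0    = Summation.power⊗≡0 K 1≤h
      d , min = plane-minimum-distance q⊗≡0
  -- Dimensions are passed reduced by one: the plane has index 1, and `1 ≤ n` is what the transfer
  -- requires.
  in d , minimum-distance-transfer q⊗≡0 (ℕ.≤⇒≤′ (ℕ.≤-trans (ℕ.n≤1+n 1) 2≤n)) min , min
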